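{- Let $\sigma,\pi\in S_n$. Then $[\sigma]\prec[\pi]$ if and only if $D(\sigma)$ is isomorphic to a proper directed subgraph of either $D(\pi)$ or $D(\pi^{ -1})$.
   Context: Inversion set: $E(\pi)=\{(i,j):1\le i<j\le n,\ \pi^{ -1}(i)>\pi^{ -1}(j)\}$. $D(\pi)$ is the digraph with vertex set $\{1,\dots,n\}$ and arc set $E(\pi)$. (Subgraphs are not required to be induced.) Geometric graphs: a geometric graph is a simple graph together with a straight-line drawing in the plane with vertices in general position (no three vertices collinear, no three edges crossing at a single point). Two edges cross if they meet at a point interior to both. A geo-isomorphism is a vertex bijection preserving adjacency, non-adjacency, crossings and non-crossings of edges. For geometric realizations $\overline{G},\widehat{G}$ of a simple graph $G$, $\overline{G}\preceq\widehat{G}$ iff there is a graph isomorphism $f:G\to G$ such that whenever $xy$ crosses $uv$ in $\overline G$, $f(x)f(y)$ crosses $f(u)f(v)$ in $\widehat G$; this is a partial order on geo-isomorphism classes of realizations of $G$. The vertex set of $K_{2,n}$ is $\{a,b\}\cup\{1,\dots,n\}$, with $a$ and $b$ each adjacent to all of $1,\dots,n$. Realization $\overline{K}_{2,n}(\pi)$ for $\pi\in S_n$: from each of two points $a,b\in\mathbb{R}^2$ draw $n$ rays, all on the same side of the line $ab$, such that each ray from $a$ meets each ray from $b$ (and generic, so that general position holds). Label the rays from $b$ as $1,\dots,n$ in increasing order of the angle they make with the segment $ba$; label the rays from $a$ as $\pi(1),\dots,\pi(n)$ in increasing order of the angle they make with the segment $ab$. Place vertex $i$ at the intersection of the two rays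 labeled $i$, and draw the segments $ai$, $bi$ for all $i$. Geo-equivalence and order: $\sigma\sim\pi$ iff $\overline{K}_{2,n}(\sigma)$ and $\overline{K}_{2,n}(\pi)$ are geo-isomorphic; $[\pi]$ is the equivalence class of $\pi$ in $S_n$; $[\sigma]\preceq[\pi]$ iff $\overline{K}_{2,n}(\sigma)\preceq\overline{K}_{2,n}(\pi)$; $[\sigma]\prec[\pi]$ means $[\sigma]\preceq[\pi]$ and $[\sigma]\ne[\pi]$. -}

module Defs where

open import Algebra.Apartness.Bundles using (HeytingField)
open import Data.Empty using (⊥)
open import Data.Fin.Base as Fin using (Fin)
open import Data.Fin.Permutation using (Permutation′; _⟨$⟩ʳ_; _⟨$⟩ˡ_)
open import Data.Nat.Base as ℕ using (ℕ; zero; suc)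
open import Data.Product.Base using (_×_; _,_; ∃; ∃-syntax)
open import Data.Sum.Base using (_⊎_; [_,_]′)
open import Data.Unit.Base using (⊤; tt)
open import Function.Bundles using (_⇔_; _↔_; Inverse; Equivalence)
open import Function.Definitions using (Injective)
open import Level using (0ℓ; _⊔_) renaming (suc to lsuc)
open import Relation.Binary.Core using (Rel)
open import Relation.Binary.PropositionalEquality.Core using (_≡_; _≢_)
open import Relation.Binary.Structures using (IsStrictPartialOrder)
open import Relation.Nullary.Negation.Core using (¬_)
open import Relation.Unary using (Pred)

------------------------------------------------------------------------
-- The real numbers

-- ℝ is given by its axioms: a Cauchy complete Archimedean ordered field.
-- Classically this determines ℝ up to isomorphism.  The axioms are
-- phrased constructively (apartness x # y means x < y or y < x, and
-- trichotomy is not assumed), so that they also hold of the constructive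
-- reals.

record OrderedField c ℓ₁ ℓ₂ ℓ₃ : Set (lsuc (c ⊔ ℓ₁ ⊔ ℓ₂ ⊔ ℓ₃)) where
  field
    heytingField : HeytingField c ℓ₁ ℓ₂

  open HeytingField heytingField public

  infix 4 _<_
  field
    _<_                  : Rel Carrier ℓ₃
    isStrictPartialOrder : IsStrictPartialOrder _≈_ _<_
    #⇔<⊎>                : ∀ x y → x # y ⇔ (x < y ⊎ y < x)
    +-monoˡ-<            : ∀ {x y} z → x < y → x + z < y + z
    *-pos                : ∀ {x y} → 0# < x → 0# < y → 0# < x * y

  fromℕ : ℕ → Carrier
  fromℕ zero    = 0#
  fromℕ (suc n) = 1# + fromℕ n

  -- ∣ x - y ∣ < ε
  Within : Carrier → Carrier → Carrier → Set ℓ₃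
  Within ε x y = (x < y + ε) × (y < x + ε)

  Cauchy : (ℕ → Carrier) → Set (c ⊔ ℓ₃)
  Cauchy s = ∀ ε → 0# < ε →
    ∃[ N ] (∀ m n → N ℕ.≤ m → N ℕ.≤ n → Within ε (s m) (s n))

  ConvergesTo : (ℕ → Carrier) → Carrier → Set (c ⊔ ℓ₃)
  ConvergesTo s x = ∀ ε → 0# < ε →
    ∃[ N ] (∀ n → N ℕ.≤ n → Within ε (s n) x)

record Reals c ℓ₁ ℓ₂ ℓ₃ : Set (lsuc (c ⊔ ℓ₁ ⊔ ℓ₂ ⊔ ℓ₃)) where
  field
    orderedField : OrderedField c ℓ₁ ℓ₂ ℓ₃

  open OrderedField orderedField public

  field
    archimedean : ∀ x → ∃[ n ] (x < fromℕ n)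
    complete    : ∀ s → Cauchy s → ∃[ x ] ConvergesTo s x

------------------------------------------------------------------------
-- Simple graphs

record SimpleGraph : Set₁ where
  field
    Vertex : Set
    Adj    : Rel Vertex 0ℓ
    sym    : ∀ {x y} → Adj x y → Adj y x
    irrefl : ∀ {x} → ¬ Adj x x

open SimpleGraph public using (Vertex; Adj)

record Edge (G : SimpleGraph) : Set where
  constructor edge
  field
    {end₁ end₂} : Vertex G
    adj         : Adj G end₁ end₂

open Edge public

-- Edges are unordered pairs of vertices.
SameEdge : ∀ {G} → Edge G → Edge G → Set
SameEdge e f = (end₁ e ≡ end₁ f × end₂ e ≡ end₂ f)
             ⊎ (end₁ e ≡ end₂ f × end₂ e ≡ end₁ f)

record GraphIso (G H : SimpleGraph) : Set where
  field
    bijection : Vertex G ↔ Vertex H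

  open Inverse bijection public using (to)

  field
    adj⇔ : ∀ x y → Adj G x y ⇔ Adj H (to x) (to y)

  onEdge : Edge G → Edge H
  onEdge e = edge (Equivalence.to (adj⇔ (end₁ e) (end₂ e)) (adj e))

data K₂-Vertex (n : ℕ) : Set where
  a b : K₂-Vertex n
  mid : Fin n → K₂-Vertex n

K₂-Adj : ∀ {n} → Rel (K₂-Vertex n) 0ℓ
K₂-Adj a       (mid _) = ⊤
K₂-Adj b       (mid _) = ⊤
K₂-Adj (mid _) a       = ⊤
K₂-Adj (mid _) b       = ⊤
K₂-Adj _       _       = ⊥

K₂ : ℕ → SimpleGraph
K₂ n = record
  { Vertex = K₂-Vertex n
  ; Adj    = K₂-Adj
  ; sym    = λ {x} {y} → K₂-sym x y
  ; irrefl = λ {x} → K₂-irrefl x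
  }
  where
  K₂-sym : ∀ (x y : K₂-Vertex n) → K₂-Adj x y → K₂-Adj y x
  K₂-sym a       (mid _) _ = tt
  K₂-sym b       (mid _) _ = tt
  K₂-sym (mid _) a       _ = tt
  K₂-sym (mid _) b       _ = tt

  K₂-irrefl : ∀ (x : K₂-Vertex n) → ¬ K₂-Adj x x
  K₂-irrefl a       ()
  K₂-irrefl b       ()
  K₂-irrefl (mid _) ()

------------------------------------------------------------------------
-- Geometric graphs in the plane

module Plane {c ℓ₁ ℓ₂ ℓ₃} (ℝ : Reals c ℓ₁ ℓ₂ ℓ₃) where

  open Reals ℝ

  Point Vector : Set c
  Point  = Carrier × Carrier
  Vector = Carrier × Carrier

  infix 4 _≈ₚ_
  _≈ₚ_ : Rel Point ℓ₁
  (x , y) ≈ₚ (x′ , y′) = (x ≈ x′) × (y ≈ y′)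

  infixl 6 _+ᵥ_
  _+ᵥ_ : Point → Vector → Point
  (x , y) +ᵥ (u , v) = x + u , y + v

  infixr 7 _*ᵥ_
  _*ᵥ_ : Carrier → Vector → Vector
  t *ᵥ (u , v) = t * u , t * v

  -- The vector from P to Q.
  _⟶_ : Point → Point → Vector
  (x , y) ⟶ (x′ , y′) = x′ - x , y′ - y

  det : Vector → Vector → Carrier
  det (u , v) (u′ , v′) = u * v′ - v * u′

  Collinear : Point → Point → Point → Set ℓ₁
  Collinear P Q R = det (P ⟶ Q) (P ⟶ R) ≈ 0#

  -- X lies on the open segment PQ.
  InteriorTo : Point → Point → Point → Set (c ⊔ ℓ₁ ⊔ ℓ₃)
  InteriorTo P Q X =
    ∃[ t ] (0# < t × t < 1# × X ≈ₚ P +ᵥ t *ᵥ (P ⟶ Q))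

  record Realization (G : SimpleGraph) : Set (c ⊔ ℓ₁ ⊔ ℓ₃) where
    field
      pos : Vertex G → Point

    OnEdge : Edge G → Point → Set (c ⊔ ℓ₁ ⊔ ℓ₃)
    OnEdge e = InteriorTo (pos (end₁ e)) (pos (end₂ e))

    field
      distinct     : ∀ {x y} → x ≢ y → ¬ (pos x ≈ₚ pos y)
      noCollinear  : ∀ {x y z} → x ≢ y → y ≢ z → x ≢ z →
                     ¬ Collinear (pos x) (pos y) (pos z)
      noConcurrent : ∀ {e f g : Edge G} →
                     ¬ SameEdge e f → ¬ SameEdge f g → ¬ SameEdge e g →
                     ¬ (∃[ X ] (OnEdge e X × OnEdge f X × OnEdge g X))

  Crosses : ∀ {G} → Realization G → Rel (Edge G) (c ⊔ ℓ₁ ⊔ ℓ₃)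
  Crosses Ḡ e f = ¬ SameEdge e f × ∃[ X ] (OnEdge e X × OnEdge f X)
    where open Realization Ḡ using (OnEdge)

  GeoIsomorphic : ∀ {G H} → Realization G → Realization H → Set (c ⊔ ℓ₁ ⊔ ℓ₃)
  GeoIsomorphic {G} {H} Ḡ H̄ = ∃ λ (f : GraphIso G H) → let open GraphIso f in
    ∀ e e′ → Crosses Ḡ e e′ ⇔ Crosses H̄ (onEdge e) (onEdge e′)

  infix 4 _≼ᵍ_
  _≼ᵍ_ : ∀ {G} → Rel (Realization G) (c ⊔ ℓ₁ ⊔ ℓ₃)
  _≼ᵍ_ {G} Ḡ Ĝ = ∃ λ (f : GraphIso G G) → let open GraphIso f in
    ∀ e e′ → Crosses Ḡ e e′ → Crosses Ĝ (onEdge e) (onEdge e′)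

  ----------------------------------------------------------------------
  -- The realizations of K₂ₙ coming from permutations

  OnRay : Point → Vector → Point → Set (c ⊔ ℓ₁ ⊔ ℓ₃)
  OnRay P d X = ∃[ t ] (0# < t × X ≈ₚ P +ᵥ t *ᵥ d)

  SameSide : ∀ {I : Set} → Vector → (I → Vector) → Set ℓ₃
  SameSide w d = (∀ i → 0# < det w (d i)) ⊎ (∀ i → det w (d i) < 0#)

  -- For u and v on the same side of w: the angle from w to u is smaller
  -- than the angle from w to v, i.e. u points into the interior of the
  -- convex angle spanned by w and v.
  AngleLess : Vector → Rel Vector (c ⊔ ℓ₁ ⊔ ℓ₃)
  AngleLess w u v =
    ∃[ x ] ∃[ y ] (0# < x × 0# < y × u ≈ₚ (x *ᵥ w) +ᵥ (y *ᵥ v))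

  -- The rays from each of the two points are indexed in increasing order
  -- of angle, so that the k-th ray from a carries the label π(k), and the
  -- i-th ray from b carries the label i.
  record RayDrawing {n} (π : Permutation′ n) : Set (c ⊔ ℓ₁ ⊔ ℓ₃) where
    field
      realization : Realization (K₂ n)

    open Realization realization public using (pos)

    field
      rayᵃ rayᵇ : Fin n → Vector
      sameSide  : SameSide (pos a ⟶ pos b) [ rayᵃ , rayᵇ ]′
      meet      : ∀ k l → ∃[ X ] (OnRay (pos a) (rayᵃ k) X ×
                                  OnRay (pos b) (rayᵇ l) X)
      angleᵃ    : ∀ {k l} → k Fin.< l →
                  AngleLess (pos a ⟶ pos b) (rayᵃ k) (rayᵃ l)
      angleᵇ    : ∀ {k l} → k Fin.< l →
                  AngleLess (pos b ⟶ pos a) (rayᵇ k) (rayᵇ l)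
      vertexᵃ   : ∀ k → OnRay (pos a) (rayᵃ k) (pos (mid (π ⟨$⟩ʳ k)))
      vertexᵇ   : ∀ i → OnRay (pos b) (rayᵇ i) (pos (mid i))

  -- A choice of points and rays for each π ∈ Sₙ.
  Drawings : ℕ → Set (c ⊔ ℓ₁ ⊔ ℓ₃)
  Drawings n = (π : Permutation′ n) → RayDrawing π

  -- Elements of Sₙ stand for their classes: _∼_ is equality of classes,
  -- and _≼_, _≺_ are the induced relations on classes.
  module Order {n} (K̄ : Drawings n) where

    infix 4 _∼_ _≼_ _≺_

    _∼_ : Rel (Permutation′ n) (c ⊔ ℓ₁ ⊔ ℓ₃)
    σ ∼ π = GeoIsomorphic (RayDrawing.realization (K̄ σ))
                          (RayDrawing.realization (K̄ π))

    _≼_ : Rel (Permutation′ n) (c ⊔ ℓ₁ ⊔ ℓ₃)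
    σ ≼ π = RayDrawing.realization (K̄ σ) ≼ᵍ RayDrawing.realization (K̄ π)

    _≺_ : Rel (Permutation′ n) (c ⊔ ℓ₁ ⊔ ℓ₃)
    σ ≺ π = σ ≼ π × ¬ (σ ∼ π)

------------------------------------------------------------------------
-- Digraphs

record Digraph : Set₁ where
  field
    Node : Set
    Arc  : Rel Node 0ℓ

open Digraph public

record Subdigraph (H : Digraph) : Set₁ where
  field
    NodeIn : Pred (Node H) 0ℓ
    ArcIn  : Rel (Node H) 0ℓ
    arc    : ∀ {x y} → ArcIn x y → Arc H x y
    source : ∀ {x y} → ArcIn x y → NodeIn x
    target : ∀ {x y} → ArcIn x y → NodeIn y

  Proper : Set
  Proper = (∃[ x ] ¬ NodeIn x)
         ⊎ (∃[ x ] ∃[ y ] (Arc H x y × ¬ ArcIn x y))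

record _≅_ (G : Digraph) {H : Digraph} (S : Subdigraph H) : Set where
  open Subdigraph S
  field
    to        : Node G → Node H
    injective : Injective _≡_ _≡_ to
    image     : ∀ y → NodeIn y ⇔ (∃[ x ] to x ≡ y)
    arcs      : ∀ x y → Arc G x y ⇔ ArcIn (to x) (to y)

IsoToProperSubdigraph : Digraph → Digraph → Set₁
IsoToProperSubdigraph G H = ∃ λ (S : Subdigraph H) → Subdigraph.Proper S × G ≅ S

D : ∀ {n} → Permutation′ n → Digraph
D {n} π = record
  { Node = Fin n
  ; Arc  = λ i j → i Fin.< j × (π ⟨$⟩ˡ j) Fin.< (π ⟨$⟩ˡ i)
  }

{-# OPTIONS --safe #-}
module Submission where

-- Edges a i and b j cross in K̄₂,ₙ(π) exactly when (j , i) is an inversion of π: tilting the ray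
-- from b towards a moves its intersection with a fixed ray from a closer to a.  An automorphism of K₂,ₙ
-- permutes {1, …, n} and keeps or exchanges a and b (except possibly for n = 2), so it preserves
-- crossings iff it embeds the inversions of σ into those of π or into the reversed inversions of
-- π; the latter form a digraph isomorphic to D(π⁻¹).  An embedding that misses an arc excludes a
-- geo-isomorphism, since it maps a finite set of crossings injectively but not onto.

open import Defs
open import Algebra.Apartness.Bundles using (HeytingCommutativeRing)
import Algebra.Apartness.Properties.HeytingCommutativeRing
open import Algebra.Bundles using (CommutativeRing; RawRing)
import Algebra.Properties.CommutativeSemigroup
import Algebra.Properties.Ring
import Algebra.Properties.Semiring.Mult
import Algebra.Solver.Ring
open import Algebra.Solver.Ring.AlmostCommutativeRing
  using (fromCommutativeRing; _-Raw-AlmostCommutative⟶_)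
open import Data.Bool.Base using (Bool; true; false; _xor_; not)
import Data.Bool.Properties as Bool
open import Data.Empty using (⊥)
open import Data.Fin.Base as Fin using (Fin; toℕ)
open import Data.Fin.Patterns using (0F; 1F)
open import Data.Fin.Permutation as Perm
  using (Permutation′; permutation; flip; _⟨$⟩ʳ_; _⟨$⟩ˡ_; inverseˡ; inverseʳ; _∘ₚ_)
import Data.Fin.Properties as Fin
open import Data.Maybe.Base using (map)
open import Data.Nat.Base as ℕ using (ℕ; zero; suc; s≤s)
open import Data.Nat.GeneralisedArithmetic using (fold)
import Data.Nat.Properties as ℕ
open import Data.Product.Base as Product using (_×_; _,_; ∃; ∃-syntax; proj₁; proj₂)
open import Data.Product.Function.NonDependent.Propositional using (_×-↔_)
open import Data.Sum.Base using (_⊎_; inj₁; inj₂; [_,_]′)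
open import Data.Unit.Base using (⊤; tt)
open import Function.Base using (_∘_; id)
open import Function.Bundles
  using (_⇔_; _↣_; _↔_; Equivalence; Inverse; Injection; mk⇔; mk↔ₛ′)
open import Function.Construct.Composition using (_↔-∘_)
open import Function.Construct.Symmetry using (↔-sym)
open import Function.Definitions using (Injective)
open import Function.Properties.Inverse using (↔⇒↣; ↔-refl)
open import Level using (0ℓ)
open import Relation.Binary.Core using (Rel)
open import Relation.Binary.Definitions using (tri<; tri≈; tri>; Decidable)
open import Relation.Binary.PropositionalEquality.Core as ≡ using (_≡_; _≢_)
import Relation.Binary.Reasoning.Setoid
open import Relation.Binary.Structures using (IsStrictPartialOrder)
open import Relation.Nullary.Decidable
  using (yes; no; _×-dec_; ¬?; decidable-stable; dec⇒maybe)
open import Relation.Nullary.Negation.Core using (¬_; contradiction)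

-- Ring identities with cancelling coefficients

-- The coefficient (p , q) stands for the integer p − q, so that the solver
-- can cancel terms although equality in the ring is undecidable.
module DifferenceSolver {c ℓ} (R : CommutativeRing c ℓ) where

  open CommutativeRing R
  open Algebra.Properties.Ring ring
  open Algebra.Properties.Semiring.Mult semiring
    using (×-homo-+; ×1-homo-*) renaming (_×_ to _∙_)
  open Algebra.Properties.CommutativeSemigroup +-commutativeSemigroup using (interchange)
  open Relation.Binary.Reasoning.Setoid setoid

  reduce : ℕ × ℕ → ℕ × ℕ
  reduce (p , q) = p ℕ.∸ q , q ℕ.∸ p

  -- Reduced results make equal coefficients syntactically equal.
  differences : RawRing 0ℓ 0ℓ
  differences = record
    { Carrier = ℕ × ℕ
    ; _≈_ = _≡_
    ; _+_ = λ (p , q) (r , s) → reduce (p ℕ.+ r , q ℕ.+ s)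
    ; _*_ = λ (p , q) (r , s) → reduce (p ℕ.* r ℕ.+ q ℕ.* s , p ℕ.* s ℕ.+ q ℕ.* r)
    ; -_  = λ (p , q) → q , p
    ; 0#  = 0 , 0
    ; 1#  = 1 , 0
    }

  ⟦_⟧ : ℕ × ℕ → Carrier
  ⟦ p , q ⟧ = p ∙ 1# - q ∙ 1#

  difference-+ : ∀ x y z w → (x + z) - (y + w) ≈ (x - y) + (z - w)
  difference-+ x y z w = begin
    (x + z) - (y + w)      ≈⟨ +-congˡ (-‿+-comm y w) ⟨
    (x + z) + (- y + - w)  ≈⟨ interchange x z (- y) (- w) ⟩
    (x - y) + (z - w)      ∎

  difference-* : ∀ x y z w → (x * z + y * w) - (x * w + y * z) ≈ (x - y) * (z - w)
  difference-* x y z w = begin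
    (x * z + y * w) - (x * w + y * z)      ≈⟨ difference-+ (x * z) (x * w) (y * w) (y * z) ⟩
    (x * z - x * w) + (y * w - y * z)      ≈⟨ +-cong (x[y-z]≈xy-xz x z w) (x[y-z]≈xy-xz y w z) ⟨
    x * (z - w) + y * (w - z)              ≈⟨ +-congˡ (*-congˡ (⁻¹-anti-homo‿- z w)) ⟨
    x * (z - w) + y * - (z - w)            ≈⟨ +-congˡ (-‿distribʳ-* y (z - w)) ⟨
    x * (z - w) - y * (z - w)              ≈⟨ [y-z]x≈yx-zx (z - w) x y ⟨
    (x - y) * (z - w)                      ∎

  -- Cross-addition expresses equality of integer differences. This is both the coefficient test
  -- handed to the solver and the reason why `reduce` keeps the value.
  ⟦⟧-cong : ∀ p q r s → p ℕ.+ s ≡ r ℕ.+ q → ⟦ p , q ⟧ ≈ ⟦ r , s ⟧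
  ⟦⟧-cong p q r s eq = begin
    p ∙ 1# - q ∙ 1#                        ≈⟨ +-identityʳ _ ⟨
    (p ∙ 1# - q ∙ 1#) + 0#                 ≈⟨ +-congˡ (-‿inverseʳ (s ∙ 1#)) ⟨
    (p ∙ 1# - q ∙ 1#) + (s ∙ 1# - s ∙ 1#)  ≈⟨ interchange _ _ _ _ ⟩
    (p ∙ 1# + s ∙ 1#) + (- (q ∙ 1#) - s ∙ 1#)  ≈⟨ +-cong swap (+-comm _ _) ⟩
    (r ∙ 1# + q ∙ 1#) + (- (s ∙ 1#) - q ∙ 1#)  ≈⟨ interchange _ _ _ _ ⟩
    (r ∙ 1# - s ∙ 1#) + (q ∙ 1# - q ∙ 1#)  ≈⟨ +-congˡ (-‿inverseʳ (q ∙ 1#)) ⟩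
    (r ∙ 1# - s ∙ 1#) + 0#                 ≈⟨ +-identityʳ _ ⟩
    r ∙ 1# - s ∙ 1#                        ∎
    where
    swap : p ∙ 1# + s ∙ 1# ≈ r ∙ 1# + q ∙ 1#
    swap = begin
      p ∙ 1# + s ∙ 1#  ≈⟨ ×-homo-+ 1# p s ⟨
      (p ℕ.+ s) ∙ 1#   ≡⟨ ≡.cong (_∙ 1#) eq ⟩
      (r ℕ.+ q) ∙ 1#   ≈⟨ ×-homo-+ 1# r q ⟩
      r ∙ 1# + q ∙ 1#  ∎

  ⟦reduce⟧ : ∀ x → ⟦ reduce x ⟧ ≈ ⟦ x ⟧
  ⟦reduce⟧ (p , q) = ⟦⟧-cong (p ℕ.∸ q) (q ℕ.∸ p) p q (balance p q)
    where
    balance : ∀ p q → (p ℕ.∸ q) ℕ.+ q ≡ p ℕ.+ (q ℕ.∸ p)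
    balance zero    zero    = ≡.refl
    balance zero    (suc q) = ≡.refl
    balance (suc p) zero    = ≡.refl
    balance (suc p) (suc q) = ≡.trans (ℕ.+-suc (p ℕ.∸ q) q) (≡.cong suc (balance p q))

  evaluate : differences -Raw-AlmostCommutative⟶ fromCommutativeRing R
  evaluate = record
    { ⟦_⟧    = ⟦_⟧
    ; +-homo = λ (p , q) (r , s) → trans (⟦reduce⟧ (p ℕ.+ r , q ℕ.+ s)) (trans
        (+-cong (×-homo-+ 1# p r) (-‿cong (×-homo-+ 1# q s)))
        (difference-+ (p ∙ 1#) (q ∙ 1#) (r ∙ 1#) (s ∙ 1#)))
    ; *-homo = λ (p , q) (r , s) → trans
        (⟦reduce⟧ (p ℕ.* r ℕ.+ q ℕ.* s , p ℕ.* s ℕ.+ q ℕ.* r)) (trans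
        (+-cong (homo p r q s) (-‿cong (homo p s q r)))
        (difference-* (p ∙ 1#) (q ∙ 1#) (r ∙ 1#) (s ∙ 1#)))
    ; -‿homo = λ (p , q) → sym (⁻¹-anti-homo‿- (p ∙ 1#) (q ∙ 1#))
    ; 0-homo = -‿inverseʳ 0#
    ; 1-homo = trans (+-cong (+-identityʳ 1#) -0#≈0#) (+-identityʳ 1#)
    }
    where
    homo : ∀ p r q s → (p ℕ.* r ℕ.+ q ℕ.* s) ∙ 1# ≈ (p ∙ 1#) * (r ∙ 1#) + (q ∙ 1#) * (s ∙ 1#)
    homo p r q s = trans (×-homo-+ 1# (p ℕ.* r) (q ℕ.* s)) (+-cong (×1-homo-* p r) (×1-homo-* q s))

  open Algebra.Solver.Ring differences (fromCommutativeRing R) evaluate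
    (λ (p , q) (r , s) → map (⟦⟧-cong p q r s) (dec⇒maybe (p ℕ.+ s ℕ.≟ r ℕ.+ q))) public
    using (solve; _:=_; _:+_; _:*_; _:-_; :-_)

-- Constructive ordered fields

module OrderedFieldProperties {c ℓ₁ ℓ₂ ℓ₃} (F : OrderedField c ℓ₁ ℓ₂ ℓ₃) where

  open OrderedField F

  commutativeRing : CommutativeRing c ℓ₁
  commutativeRing = HeytingCommutativeRing.commutativeRing heytingCommutativeRing

  open Algebra.Apartness.Properties.HeytingCommutativeRing heytingCommutativeRing
    using (1#0; x-0≈x; invertibleˡ⇒#)
  open IsStrictPartialOrder isStrictPartialOrder public
    using (<-respʳ-≈; <-respˡ-≈; asym)
    renaming (irrefl to <-irrefl; trans to <-trans)
  open DifferenceSolver commutativeRing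
  open Relation.Binary.Reasoning.Setoid setoid

  <⇒# : ∀ {x y} → x < y → x # y
  <⇒# x<y = Equivalence.from (#⇔<⊎> _ _) (inj₁ x<y)

  >⇒# : ∀ {x y} → y < x → x # y
  >⇒# y<x = Equivalence.from (#⇔<⊎> _ _) (inj₂ y<x)

  inverse⇒#0 : ∀ {x i} → i * x ≈ 1# → x # 0#
  inverse⇒#0 {x} {i} ix≈1 = invertibleˡ⇒# (i , trans (*-congˡ (x-0≈x x)) ix≈1)

  #0⇒inverse : ∀ {x} → x # 0# → ∃[ i ] i * x ≈ 1#
  #0⇒inverse {x} x#0 with i , i[x-0]≈1 , _ ← #⇒invertible x#0 =
    i , trans (*-congˡ (sym (x-0≈x x))) i[x-0]≈1

  *-cancelˡ-# : ∀ {x y z} → x # 0# → x * y ≈ x * z → y ≈ z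
  *-cancelˡ-# {x} {y} {z} x#0 xy≈xz with i , ix≈1 ← #0⇒inverse x#0 = begin
    y            ≈⟨ *-identityˡ y ⟨
    1# * y       ≈⟨ *-congʳ ix≈1 ⟨
    i * x * y    ≈⟨ *-assoc i x y ⟩
    i * (x * y)  ≈⟨ *-congˡ xy≈xz ⟩
    i * (x * z)  ≈⟨ *-assoc i x z ⟨
    i * x * z    ≈⟨ *-congʳ ix≈1 ⟩
    1# * z       ≈⟨ *-identityˡ z ⟩
    z            ∎

  x*y#0⇒y#0 : ∀ {x y} → x * y # 0# → y # 0#
  x*y#0⇒y#0 {x} {y} xy#0 with i , i[xy]≈1 ← #0⇒inverse xy#0 =
    inverse⇒#0 (trans (*-assoc i x y) i[xy]≈1)

  x<y⇒0<y-x : ∀ {x y} → x < y → 0# < y - x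
  x<y⇒0<y-x {x} x<y = <-respˡ-≈ (-‿inverseʳ x) (+-monoˡ-< (- x) x<y)

  0<y-x⇒x<y : ∀ {x y} → 0# < y - x → x < y
  0<y-x⇒x<y {x} {y} 0<y-x = <-respˡ-≈ (+-identityˡ x)
    (<-respʳ-≈ (solve 2 (λ y x → y :- x :+ x := y) refl y x) (+-monoˡ-< x 0<y-x))

  *-monoˡ-< : ∀ {x y} z → 0# < z → x < y → x * z < y * z
  *-monoˡ-< {x} {y} z 0<z x<y = 0<y-x⇒x<y (<-respʳ-≈
    (solve 3 (λ x y z → (y :- x) :* z := y :* z :- x :* z) refl x y z)
    (*-pos (x<y⇒0<y-x x<y) 0<z))

  0<1 : 0# < 1#
  0<1 with Equivalence.to (#⇔<⊎> _ _) 1#0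
  ... | inj₂ 0<1 = 0<1
  -- If `1# < 0#`, the square of the positive `0# - 1#` is positive and equals `1#`.
  ... | inj₁ 1<0 = <-respʳ-≈ 1*1 (*-pos 0<0-1 0<0-1)
    where
    0<0-1 = x<y⇒0<y-x 1<0
    1*1 : (0# - 1#) * (0# - 1#) ≈ 1#
    1*1 = begin
      (0# - 1#) * (0# - 1#)  ≈⟨ *-cong (+-identityˡ _) (+-identityˡ _) ⟩
      - 1# * - 1#            ≈⟨ solve 1 (λ x → :- x :* :- x := x :* x) refl 1# ⟩
      1# * 1#                ≈⟨ *-identityˡ 1# ⟩
      1#                     ∎

  divide : ∀ {x y} → 0# < x → x < y → ∃[ q ] (0# < q × q < 1# × q * y ≈ x)
  divide {x} {y} 0<x x<y with i , iy≈1 ← #0⇒inverse (>⇒# (<-trans 0<x x<y)) =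
    x * i , *-pos 0<x 0<i , <-respʳ-≈ yi≈1 (*-monoˡ-< i 0<i x<y) , xiy≈x
    where
    yi≈1 : y * i ≈ 1#
    yi≈1 = trans (*-comm y i) iy≈1
    xiy≈x : x * i * y ≈ x
    xiy≈x = begin
      x * i * y    ≈⟨ *-assoc x i y ⟩
      x * (i * y)  ≈⟨ *-congˡ iy≈1 ⟩
      x * 1#       ≈⟨ *-identityʳ x ⟩
      x            ∎
    0<i : 0# < i
    -- Having the inverse `y`, `i` is apart from zero and so has a sign; a negative `i` would make
    -- `i * y`, that is `1#`, negative.
    0<i with Equivalence.to (#⇔<⊎> _ _) (inverse⇒#0 yi≈1)
    ... | inj₂ 0<i = 0<i
    ... | inj₁ i<0 = contradiction
      (<-respʳ-≈ (zeroˡ y) (<-respˡ-≈ iy≈1 (*-monoˡ-< y (<-trans 0<x x<y) i<0)))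
      (asym 0<1)

-- Rays, segments and determinants in the plane

module PlaneProperties {c ℓ₁ ℓ₂ ℓ₃} (ℝ : Reals c ℓ₁ ℓ₂ ℓ₃) where

  open Reals ℝ
  open Plane ℝ
  open OrderedFieldProperties orderedField
  open DifferenceSolver commutativeRing
  open Relation.Binary.Reasoning.Setoid setoid
  open Algebra.Apartness.Properties.HeytingCommutativeRing heytingCommutativeRing using (#-congʳ)
  open Algebra.Properties.Ring (CommutativeRing.ring commutativeRing) using (+-cancelˡ)

  ≈ₚ-sym : ∀ {P Q} → P ≈ₚ Q → Q ≈ₚ P
  ≈ₚ-sym (e , e′) = sym e , sym e′

  ≈ₚ-trans : ∀ {P Q R} → P ≈ₚ Q → Q ≈ₚ R → P ≈ₚ R
  ≈ₚ-trans (e , e′) (f , f′) = trans e f , trans e′ f′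

  +ᵥ-congˡ : ∀ {P d e} → d ≈ₚ e → P +ᵥ d ≈ₚ P +ᵥ e
  +ᵥ-congˡ (e , e′) = +-congˡ e , +-congˡ e′

  *ᵥ-congˡ : ∀ {t d e} → d ≈ₚ e → t *ᵥ d ≈ₚ t *ᵥ e
  *ᵥ-congˡ (e , e′) = *-congˡ e , *-congˡ e′

  det-congˡ : ∀ {u v w} → u ≈ₚ v → det u w ≈ det v w
  det-congˡ (e , e′) = +-cong (*-congʳ e) (-‿cong (*-congʳ e′))

  det-*ᵥ : ∀ t u v → det (t *ᵥ u) v ≈ t * det u v
  det-*ᵥ t (u , u′) (v , v′) =
    solve 5 (λ t u u′ v v′ → t :* u :* v′ :- t :* u′ :* v := t :* (u :* v′ :- u′ :* v))
      refl t u u′ v v′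

  det-self : ∀ t v → det (t *ᵥ v) v ≈ 0#
  det-self t (v , v′) = trans
    (+-congˡ (-‿cong (solve 3 (λ t v v′ → t :* v′ :* v := t :* v :* v′) refl t v v′)))
    (-‿inverseʳ _)

  det-⟶-anti : ∀ A B v → det (B ⟶ A) v ≈ - det (A ⟶ B) v
  det-⟶-anti (α , α′) (β , β′) (v , v′) =
    solve 6 (λ α α′ β β′ v v′ → (α :- β) :* v′ :- (α′ :- β′) :* v
                             := :- ((β :- α) :* v′ :- (β′ :- α′) :* v)) refl α α′ β β′ v v′

  det-⟶-anti-# : ∀ {A B v} → det (A ⟶ B) v # 0# → det (B ⟶ A) v # 0#
  det-⟶-anti-# {A} {B} {v} ω#0 with i , iω≈1 ← #0⇒inverse ω#0 = inverse⇒#0 (begin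
    - i * det (B ⟶ A) v      ≈⟨ *-congˡ (det-⟶-anti A B v) ⟩
    - i * - det (A ⟶ B) v    ≈⟨ solve 2 (λ i ω → :- i :* :- ω := i :* ω) refl i _ ⟩
    i * det (A ⟶ B) v        ≈⟨ iω≈1 ⟩
    1#                       ∎)

  displacement : ∀ {P d Q} → P +ᵥ d ≈ₚ Q → d ≈ₚ P ⟶ Q
  displacement (e , e′) = move e , move e′
    where
    move : ∀ {p d q} → p + d ≈ q → d ≈ q - p
    move {p} {d} e = trans (solve 2 (λ p d → d := p :+ d :- p) refl p d) (+-congʳ e)

  -- Tilting the ray from B towards A moves its intersection with a fixed ray from A closer to A.
  closer : ∀ {A B u v v′ t t′ s s′} → det (A ⟶ B) v # 0# → 0# < t′ → 0# < s →
           AngleLess (B ⟶ A) v′ v →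
           A +ᵥ t *ᵥ u ≈ₚ B +ᵥ s *ᵥ v′ →
           A +ᵥ t′ *ᵥ u ≈ₚ B +ᵥ s′ *ᵥ v → t < t′
  closer {A@(α , α′)} {B@(β , β′)} {u} {v@(w , w′)} {v′} {t} {t′} {s} {s′}
         ω#0 0<t′ 0<s (x , y , 0<x , _ , v′≈) X≈ P≈ =
    -- Taking determinants with `v` removes the multiples of `v` from both equations, leaving
    -- `t′ * δ ≈ ω` and `t * δ ≈ ω - s * x * ω`. Subtracting and cancelling `δ`, whose sign is never
    -- asked for, gives `t′ - t ≈ s * x * t′`.
    0<y-x⇒x<y (<-respʳ-≈ (*-cancelˡ-# δ#0 [sxt′]δ) (*-pos (*-pos 0<s 0<x) 0<t′))
    where
    δ ω : Carrier
    δ = det u v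
    ω = det (A ⟶ B) v
    t′δ≈ω : t′ * δ ≈ ω
    t′δ≈ω = begin
      t′ * δ                           ≈⟨ det-*ᵥ t′ u v ⟨
      det (t′ *ᵥ u) v                  ≈⟨ det-congˡ (displacement P≈) ⟩
      det (A ⟶ (B +ᵥ s′ *ᵥ v)) v       ≈⟨
        solve 7 (λ α α′ β β′ w w′ s′ →
          (β :+ s′ :* w :- α) :* w′ :- (β′ :+ s′ :* w′ :- α′) :* w
          := (β :- α) :* w′ :- (β′ :- α′) :* w) refl α α′ β β′ w w′ s′ ⟩
      ω                                ∎
    tδ≈ω-sxω : t * δ ≈ ω - s * x * ω
    tδ≈ω-sxω = begin
      t * δ                            ≈⟨ det-*ᵥ t u v ⟨
      det (t *ᵥ u) v                   ≈⟨ det-congˡ (displacement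
                                            (≈ₚ-trans X≈ (+ᵥ-congˡ (*ᵥ-congˡ v′≈)))) ⟩
      det (A ⟶ (B +ᵥ s *ᵥ ((x *ᵥ (B ⟶ A)) +ᵥ (y *ᵥ v)))) v  ≈⟨
        solve 9 (λ α α′ β β′ w w′ s x y →
          (β :+ s :* (x :* (α :- β) :+ y :* w) :- α) :* w′ :-
          (β′ :+ s :* (x :* (α′ :- β′) :+ y :* w′) :- α′) :* w
          := ((β :- α) :* w′ :- (β′ :- α′) :* w) :-
             s :* x :* ((β :- α) :* w′ :- (β′ :- α′) :* w)) refl α α′ β β′ w w′ s x y ⟩
      ω - s * x * ω                    ∎
    δ#0 : δ # 0#
    δ#0 = x*y#0⇒y#0 (#-congʳ (sym t′δ≈ω) ω#0)
    [sxt′]δ : δ * (s * x * t′) ≈ δ * (t′ - t)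
    [sxt′]δ = begin
      δ * (s * x * t′)  ≈⟨
        solve 4 (λ δ s x t′ → δ :* (s :* x :* t′) := s :* x :* (t′ :* δ)) refl δ s x t′ ⟩
      s * x * (t′ * δ)               ≈⟨ *-congˡ t′δ≈ω ⟩
      s * x * ω  ≈⟨
        solve 2 (λ k ω → k :* ω := ω :- (ω :- k :* ω)) refl (s * x) ω ⟩
      ω - (ω - s * x * ω)            ≈⟨ +-cong t′δ≈ω (-‿cong tδ≈ω-sxω) ⟨
      t′ * δ - t * δ  ≈⟨
        solve 3 (λ t t′ δ → t′ :* δ :- t :* δ := δ :* (t′ :- t)) refl t t′ δ ⟩
      δ * (t′ - t)                   ∎

  interior-on-ray : ∀ {A P X u t′} → 0# < t′ → P ≈ₚ A +ᵥ t′ *ᵥ u → InteriorTo A P X →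
                    ∃[ t ] (0# < t × t < t′ × X ≈ₚ A +ᵥ t *ᵥ u)
  interior-on-ray {t′ = t′} 0<t′ (P≈ , P≈′) (τ , 0<τ , τ<1 , X≈ , X≈′) =
    τ * t′ , *-pos 0<τ 0<t′ , <-respʳ-≈ (*-identityˡ t′) (*-monoˡ-< t′ 0<t′ τ<1) ,
    trans X≈ (scale P≈) , trans X≈′ (scale P≈′)
    where
    scale : ∀ {α p u} → p ≈ α + t′ * u → α + τ * (p - α) ≈ α + τ * t′ * u
    scale {α} {p} {u} p≈ = trans (+-congˡ (*-congˡ (+-congʳ p≈)))
      (solve 4 (λ α u t′ τ → α :+ τ :* (α :+ t′ :* u :- α) := α :+ τ :* t′ :* u) refl α u t′ τ)

  on-ray-interior : ∀ {A P X u t t′} → 0# < t → t < t′ →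
                    X ≈ₚ A +ᵥ t *ᵥ u → P ≈ₚ A +ᵥ t′ *ᵥ u → InteriorTo A P X
  on-ray-interior {t = t} {t′} 0<t t<t′ (X≈ , X≈′) (P≈ , P≈′)
    with τ , 0<τ , τ<1 , τt′≈t ← divide 0<t t<t′ =
    τ , 0<τ , τ<1 , scale X≈ P≈ , scale X≈′ P≈′
    where
    scale : ∀ {α p x u} → x ≈ α + t * u → p ≈ α + t′ * u → x ≈ α + τ * (p - α)
    scale {α} {p} {x} {u} x≈ p≈ = begin
      x                            ≈⟨ x≈ ⟩
      α + t * u                    ≈⟨ +-congˡ (*-congʳ τt′≈t) ⟨
      α + τ * t′ * u  ≈⟨
        solve 4 (λ α u t′ τ → α :+ τ :* (α :+ t′ :* u :- α) := α :+ τ :* t′ :* u) refl α u t′ τ ⟨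
      α + τ * (α + t′ * u - α)     ≈⟨ +-congˡ (*-congˡ (+-congʳ p≈)) ⟨
      α + τ * (p - α)              ∎

  interior-sym : ∀ {P Q X} → InteriorTo P Q X → InteriorTo Q P X
  interior-sym (t , 0<t , t<1 , X≈ , X≈′) =
    1# - t , x<y⇒0<y-x t<1 ,
    0<y-x⇒x<y (<-respʳ-≈ (solve 2 (λ i t → t := i :- (i :- t)) refl 1# t) 0<t) ,
    trans X≈ (reverse _ _) , trans X≈′ (reverse _ _)
    where
    reverse : ∀ p q → p + t * (q - p) ≈ q + (1# - t) * (p - q)
    reverse p q = begin
      p + t * (q - p)  ≈⟨
        solve 3 (λ p q t → p :+ t :* (q :- p) := q :+ ((p :- q) :- t :* (p :- q))) refl p q t ⟩
      q + ((p - q) - t * (p - q))        ≈⟨ +-congˡ (+-congʳ (*-identityˡ _)) ⟨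
      q + (1# * (p - q) - t * (p - q))  ≈⟨
        solve 4 (λ p q t i → q :+ (i :* (p :- q) :- t :* (p :- q))
                           := q :+ (i :- t) :* (p :- q)) refl p q t 1# ⟩
      q + (1# - t) * (p - q)             ∎

  -- Excludes crossings of edges with a common endpoint. Both descriptions of `X` give
  -- `τ *ᵥ (A ⟶ P) ≈ₚ ρ *ᵥ (A ⟶ Q)`; the determinant with `A ⟶ Q` vanishes, and `τ` cancels.
  interiors-meet⇒collinear : ∀ {A P Q X} → InteriorTo A P X → InteriorTo A Q X → Collinear A P Q
  interiors-meet⇒collinear {A} {P} {Q} (τ , 0<τ , _ , X≈ , X≈′) (ρ , _ , _ , Y≈ , Y≈′) =
    *-cancelˡ-# (>⇒# 0<τ) (begin
      τ * det (A ⟶ P) (A ⟶ Q)       ≈⟨ det-*ᵥ τ (A ⟶ P) (A ⟶ Q) ⟨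
      det (τ *ᵥ (A ⟶ P)) (A ⟶ Q)    ≈⟨ det-congˡ (cancel X≈ Y≈ , cancel X≈′ Y≈′) ⟩
      det (ρ *ᵥ (A ⟶ Q)) (A ⟶ Q)    ≈⟨ det-self ρ (A ⟶ Q) ⟩
      0#                            ≈⟨ zeroʳ τ ⟨
      τ * 0#                        ∎)
    where
    cancel : ∀ {x α d e} → x ≈ α + d → x ≈ α + e → d ≈ e
    cancel {α = α} x≈ y≈ = +-cancelˡ α _ _ (trans (sym x≈) y≈)

-- Injective self-maps of finite types

module _ {A : Set} {m : ℕ} (code : A ↣ Fin m) where

  -- Among the `m + 1` iterates from `x` to the `m`-th, two coincide, and injectivity strips their
  -- common applications of `f`. The outermost `f` is kept visible so that a preimage of `x` can be
  -- read off.
  recurrent : ∀ {f : A → A} → Injective _≡_ _≡_ f → ∀ x → ∃[ k ] f (fold x f k) ≡ x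
  recurrent {f} f-inj x
    with i , j , i<j , eq ← Fin.pigeonhole (ℕ.n<1+n m) (λ i → Injection.to code (fold x f (toℕ i)))
    with k , 1+i+k≡j ← ℕ.m≤n⇒∃[o]m+o≡n i<j =
    k , ≡.sym (cancel (toℕ i) (suc k) (≡.trans (Injection.injective code eq)
          (≡.cong (fold x f) (≡.trans (≡.sym 1+i+k≡j) (≡.sym (ℕ.+-suc (toℕ i) k))))))
    where
    cancel : ∀ i d → fold x f i ≡ fold x f (i ℕ.+ d) → x ≡ fold x f d
    cancel zero    d eq = eq
    cancel (suc i) d eq = cancel i d (f-inj eq)

  preimage : ∀ {f : A → A} → Injective _≡_ _≡_ f → ∀ x → ∃[ y ] f y ≡ x
  preimage f-inj x with k , eq ← recurrent f-inj x = _ , eq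

  -- Classically: g bounds |R| by |S|, so the injection of S into R by f is onto.
  -- Here the orbits of h = g⁻¹ ∘ f are followed until they return.
  reflects : ∀ {p} {R S : A → Set p} {f g : A → A} → Injective _≡_ _≡_ f → Injective _≡_ _≡_ g →
             (∀ {x} → S x → R (f x)) → (∀ {x} → R (g x) → S x) →
             ∀ {x} → R (f x) → S x
  reflects {R = R} {S} {f} {g} f-inj g-inj S⇒R R⇒S {x} Rfx =
    let k , eq = recurrent h-inj x in ≡.subst S eq (S-orbit k)
    where
    h : A → A
    h x = proj₁ (preimage g-inj (f x))
    gh≡f : ∀ x → g (h x) ≡ f x
    gh≡f x = proj₂ (preimage g-inj (f x))
    h-inj : Injective _≡_ _≡_ h
    h-inj {x} {y} eq = f-inj (≡.trans (≡.sym (gh≡f x)) (≡.trans (≡.cong g eq) (gh≡f y)))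
    R⇒S-h : ∀ {x} → R (f x) → S (h x)
    R⇒S-h {x} = R⇒S ∘ ≡.subst R (≡.sym (gh≡f x))
    -- One step along the orbit: `S y` gives `R (f y)`, which is `R (g (h y))`, hence `S (h y)`.
    S-orbit : ∀ k → S (h (fold x h k))
    S-orbit zero    = R⇒S-h Rfx
    S-orbit (suc k) = R⇒S-h (S⇒R (S-orbit k))

injective⇒permutation : ∀ {n} {f : Fin n → Fin n} → Injective _≡_ _≡_ f →
                        ∃ λ (φ : Permutation′ n) → ∀ i → φ ⟨$⟩ʳ i ≡ f i
injective⇒permutation {f = f} f-inj =
  permutation f (proj₁ ∘ pre) (proj₂ ∘ pre) (λ x → f-inj (proj₂ (pre (f x)))) , λ _ → ≡.refl
  where pre = preimage (↔⇒↣ ↔-refl) f-inj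

-- Edges of K₂,ₙ in normal form

-- Each unordered edge occurs in `Edge` in two orientations, identified only by `SameEdge`. Spokes
-- list the hub first (`false` for `a`, `true` for `b`), so that sameness is `_≡_` and finiteness
-- applies.
Spoke : ℕ → Set
Spoke n = Bool × Fin n

module _ {n : ℕ} where

  spokes↣ : (Spoke n × Spoke n) ↣ Fin (2 ℕ.* n ℕ.* (2 ℕ.* n))
  spokes↣ = ↔⇒↣ (↔-sym ((one ×-↔ one) ↔-∘ Fin.*↔×))
    where
    one : Fin (2 ℕ.* n) ↔ Spoke n
    one = (Fin.2↔Bool ×-↔ ↔-refl) ↔-∘ Fin.*↔×

  hub : Bool → K₂-Vertex n
  hub false = a
  hub true  = b

  mid-injective : ∀ {i j : Fin n} → mid i ≡ mid j → i ≡ j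
  mid-injective ≡.refl = ≡.refl

  hub-adj : ∀ h i → K₂-Adj (hub h) (mid i)
  hub-adj false _ = tt
  hub-adj true  _ = tt

  spokeEdge : Spoke n → Edge (K₂ n)
  spokeEdge (h , i) = edge {end₁ = hub h} {mid i} (hub-adj h i)

  toSpoke : Edge (K₂ n) → Spoke n
  toSpoke (edge {a}     {mid i} _) = false , i
  toSpoke (edge {b}     {mid i} _) = true , i
  toSpoke (edge {mid i} {a}     _) = false , i
  toSpoke (edge {mid i} {b}     _) = true , i

  SameEdge-sym : ∀ (e f : Edge (K₂ n)) → SameEdge e f → SameEdge f e
  SameEdge-sym _ _ (inj₁ (p , q)) = inj₁ (≡.sym p , ≡.sym q)
  SameEdge-sym _ _ (inj₂ (p , q)) = inj₂ (≡.sym q , ≡.sym p)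

  SameEdge-trans : ∀ (e f g : Edge (K₂ n)) → SameEdge e f → SameEdge f g → SameEdge e g
  SameEdge-trans _ _ _ (inj₁ (p , q)) (inj₁ (r , s)) = inj₁ (≡.trans p r , ≡.trans q s)
  SameEdge-trans _ _ _ (inj₁ (p , q)) (inj₂ (r , s)) = inj₂ (≡.trans p r , ≡.trans q s)
  SameEdge-trans _ _ _ (inj₂ (p , q)) (inj₁ (r , s)) = inj₂ (≡.trans p s , ≡.trans q r)
  SameEdge-trans _ _ _ (inj₂ (p , q)) (inj₂ (r , s)) = inj₁ (≡.trans p s , ≡.trans q r)

  spokeEdge-toSpoke : ∀ e → SameEdge (spokeEdge (toSpoke e)) e
  spokeEdge-toSpoke (edge {a}     {mid i} _) = inj₁ (≡.refl , ≡.refl)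
  spokeEdge-toSpoke (edge {b}     {mid i} _) = inj₁ (≡.refl , ≡.refl)
  spokeEdge-toSpoke (edge {mid i} {a}     _) = inj₂ (≡.refl , ≡.refl)
  spokeEdge-toSpoke (edge {mid i} {b}     _) = inj₂ (≡.refl , ≡.refl)

  toSpoke-ends : ∀ {h i} e → end₁ e ≡ hub h → end₂ e ≡ mid i → toSpoke e ≡ (h , i)
  toSpoke-ends {false} (edge _) ≡.refl ≡.refl = ≡.refl
  toSpoke-ends {true}  (edge _) ≡.refl ≡.refl = ≡.refl

  toSpoke-ends′ : ∀ {h i} e → end₁ e ≡ mid i → end₂ e ≡ hub h → toSpoke e ≡ (h , i)
  toSpoke-ends′ {false} (edge _) ≡.refl ≡.refl = ≡.refl
  toSpoke-ends′ {true}  (edge _) ≡.refl ≡.refl = ≡.refl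

  toSpoke-spokeEdge : ∀ s → toSpoke (spokeEdge s) ≡ s
  toSpoke-spokeEdge s = toSpoke-ends (spokeEdge s) ≡.refl ≡.refl

  toSpoke-cong : ∀ e f → SameEdge e f → toSpoke e ≡ toSpoke f
  toSpoke-cong e f e≈f
    with SameEdge-trans e f (spokeEdge (toSpoke f)) e≈f
      (SameEdge-sym (spokeEdge (toSpoke f)) f (spokeEdge-toSpoke f))
  ... | inj₁ (p , q) = toSpoke-ends e p q
  ... | inj₂ (p , q) = toSpoke-ends′ e p q

  toSpoke-injective : ∀ e f → toSpoke e ≡ toSpoke f → SameEdge e f
  toSpoke-injective e f eq = SameEdge-trans e (spokeEdge (toSpoke e)) f
    (SameEdge-sym (spokeEdge (toSpoke e)) e (spokeEdge-toSpoke e))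
    (≡.subst (λ s → SameEdge (spokeEdge s) f) (≡.sym eq) (spokeEdge-toSpoke f))

  module SpokeMap (f : GraphIso (K₂ n) (K₂ n)) where
    open GraphIso f

    to-injective : Injective _≡_ _≡_ to
    to-injective = Injection.injective (↔⇒↣ bijection)

    onSpoke : Spoke n → Spoke n
    onSpoke s = toSpoke (onEdge (spokeEdge s))

    onEdge-cong : ∀ d e → SameEdge d e → SameEdge (onEdge d) (onEdge e)
    onEdge-cong _ _ (inj₁ (p , q)) = inj₁ (≡.cong to p , ≡.cong to q)
    onEdge-cong _ _ (inj₂ (p , q)) = inj₂ (≡.cong to p , ≡.cong to q)

    onEdge-injective : ∀ d e → SameEdge (onEdge d) (onEdge e) → SameEdge d e
    onEdge-injective _ _ (inj₁ (p , q)) = inj₁ (to-injective p , to-injective q)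
    onEdge-injective _ _ (inj₂ (p , q)) = inj₂ (to-injective p , to-injective q)

    onSpoke-toSpoke : ∀ e → onSpoke (toSpoke e) ≡ toSpoke (onEdge e)
    onSpoke-toSpoke e = toSpoke-cong (onEdge (spokeEdge (toSpoke e))) (onEdge e)
      (onEdge-cong (spokeEdge (toSpoke e)) e (spokeEdge-toSpoke e))

    onSpoke-injective : Injective _≡_ _≡_ onSpoke
    onSpoke-injective {s} {t} eq = ≡.trans (≡.sym (toSpoke-spokeEdge s)) (≡.trans
      (toSpoke-cong (spokeEdge s) (spokeEdge t) (onEdge-injective (spokeEdge s) (spokeEdge t)
        (toSpoke-injective (onEdge (spokeEdge s)) (onEdge (spokeEdge t)) eq)))
      (toSpoke-spokeEdge t))

  open SpokeMap public using (onSpoke; onSpoke-toSpoke; onSpoke-injective; to-injective)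

  -- Exchanging the hubs is an involution, so the inverse uses the same `s` with `flip φ`; adjacency
  -- is reflected because this inverse preserves it.
  relabel : Bool → Permutation′ n → GraphIso (K₂ n) (K₂ n)
  relabel s φ = record
    { bijection = mk↔ₛ′ (move s φ) (move s (flip φ)) (move-inverse s φ (inverseʳ φ))
                        (move-inverse s (flip φ) (inverseˡ φ))
    ; adj⇔ = λ x y → mk⇔ (move-adj s φ x y) (adj-move s φ x y)
    }
    where
    move : Bool → Permutation′ n → K₂-Vertex n → K₂-Vertex n
    move s φ a       = hub s
    move s φ b       = hub (not s)
    move s φ (mid i) = mid (φ ⟨$⟩ʳ i)

    move-inverse : ∀ s φ → (∀ {i} → φ ⟨$⟩ʳ (φ ⟨$⟩ˡ i) ≡ i) →
                   ∀ x → move s φ (move s (flip φ) x) ≡ x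
    move-inverse false φ inv a       = ≡.refl
    move-inverse true  φ inv a       = ≡.refl
    move-inverse false φ inv b       = ≡.refl
    move-inverse true  φ inv b       = ≡.refl
    move-inverse s     φ inv (mid i) = ≡.cong mid inv

    move-adj : ∀ s φ x y → K₂-Adj x y → K₂-Adj (move s φ x) (move s φ y)
    move-adj s φ a       (mid i) _ = hub-adj s _
    move-adj s φ b       (mid i) _ = hub-adj (not s) _
    move-adj s φ (mid i) a       _ = SimpleGraph.sym (K₂ n) {hub s} {mid _} (hub-adj s _)
    move-adj s φ (mid i) b       _ =
      SimpleGraph.sym (K₂ n) {hub (not s)} {mid _} (hub-adj (not s) _)

    adj-move : ∀ s φ x y → K₂-Adj (move s φ x) (move s φ y) → K₂-Adj x y
    adj-move s φ x y adj = ≡.subst₂ K₂-Adj (back x) (back y) (move-adj s (flip φ) _ _ adj)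
      where back = move-inverse s (flip φ) (inverseˡ φ)

  onSpoke-relabel : ∀ s φ h i → onSpoke (relabel s φ) (h , i) ≡ (s xor h , φ ⟨$⟩ʳ i)
  onSpoke-relabel false φ false i = ≡.refl
  onSpoke-relabel false φ true  i = ≡.refl
  onSpoke-relabel true  φ false i = ≡.refl
  onSpoke-relabel true  φ true  i = ≡.refl

-- Crossings in a ray drawing are inversions

Inversion : ∀ {n} → Permutation′ n → Rel (Fin n) 0ℓ
Inversion π = Arc (D π)

-- For R the inversions of π this says which edges of K̄₂,ₙ(π) cross.
Cross : ∀ {n} → Rel (Fin n) 0ℓ → Rel (Spoke n) 0ℓ
Cross R (false , i) (true  , j) = R j i
Cross R (true  , j) (false , i) = R j i
Cross R (false , _) (false , _) = ⊥
Cross R (true  , _) (true  , _) = ⊥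

module Drawing {c ℓ₁ ℓ₂ ℓ₃} (ℝ : Reals c ℓ₁ ℓ₂ ℓ₃) where

  open Reals ℝ
  open Plane ℝ
  open PlaneProperties ℝ
  open OrderedFieldProperties orderedField

  -- `X` lies on a ray from `B` tilted further towards `A` than the ray through `P`, so by `closer`
  -- it comes before `P`. Applied once from each hub, this puts a meeting point of two rays on both
  -- segments.
  crossed : ∀ {A B P X u v v′} → det (A ⟶ B) v # 0# → AngleLess (B ⟶ A) v′ v →
            OnRay A u P → OnRay B v P → OnRay A u X → OnRay B v′ X → InteriorTo A P X
  crossed ω#0 v′<v (t′ , 0<t′ , P≈) (s′ , _ , P≈′) (t , 0<t , X≈) (s , 0<s , X≈′) =
    on-ray-interior 0<t t<t′ X≈ P≈
    where
    t<t′ = closer ω#0 0<t′ 0<s v′<v (≈ₚ-trans (≈ₚ-sym X≈) X≈′) (≈ₚ-trans (≈ₚ-sym P≈) P≈′)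

  interior⇒onRay : ∀ {A u P X} → OnRay A u P → InteriorTo A P X → OnRay A u X
  interior⇒onRay (t′ , 0<t′ , P≈) X∈AP =
    let t , 0<t , _ , X≈ = interior-on-ray 0<t′ P≈ X∈AP in t , 0<t , X≈

  -- A common point `X` would precede `P` on the ray from `A`; but `P` is on the ray from `B` nearer
  -- to `A` than the one through `X`, so `closer` puts `P` before `X`.
  uncrossed : ∀ {A B P Q X u v v′} → det (A ⟶ B) v # 0# → AngleLess (B ⟶ A) v′ v →
              OnRay A u P → OnRay B v′ P → OnRay B v Q →
              InteriorTo A P X → ¬ InteriorTo B Q X
  uncrossed ω#0 v′<v (t′ , 0<t′ , P≈) (s′ , 0<s′ , P≈′) Q∈ X∈AP X∈BQ =
    let t , 0<t , t<t′ , X≈ = interior-on-ray 0<t′ P≈ X∈AP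
        s , _ , X≈′         = interior⇒onRay Q∈ X∈BQ in
    asym t<t′ (closer ω#0 0<t 0<s′ v′<v (≈ₚ-trans (≈ₚ-sym P≈) P≈′) (≈ₚ-trans (≈ₚ-sym X≈) X≈′))

  onEdge-resp : ∀ {G} (Ḡ : Realization G) (e f : Edge G) {X} → SameEdge e f →
                Realization.OnEdge Ḡ e X → Realization.OnEdge Ḡ f X
  onEdge-resp Ḡ (edge _) (edge _) (inj₁ (≡.refl , ≡.refl)) X∈e = X∈e
  onEdge-resp Ḡ (edge _) (edge _) (inj₂ (≡.refl , ≡.refl)) X∈e = interior-sym X∈e

  module _ {n} {π : Permutation′ n} (K : RayDrawing π) where

    open RayDrawing K
    open Realization realization using (noCollinear)

    -- The `k`-th ray from `a` carries the label `π ⟨$⟩ʳ k`, so `rank i` is the position at `a` of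
    -- the ray through vertex `i`.
    rank : Fin n → Fin n
    rank i = π ⟨$⟩ˡ i

    vertexᵃ-rank : ∀ i → OnRay (pos a) (rayᵃ (rank i)) (pos (mid i))
    vertexᵃ-rank i = ≡.subst (λ j → OnRay (pos a) (rayᵃ (rank i)) (pos (mid j)))
      (inverseʳ π) (vertexᵃ (rank i))

    det-rayᵃ : ∀ k → det (pos b ⟶ pos a) (rayᵃ k) # 0#
    det-rayᵃ k = det-⟶-anti-# ([ (λ s → >⇒# (s (inj₁ k))) , (λ s → <⇒# (s (inj₁ k))) ]′ sameSide)

    det-rayᵇ : ∀ k → det (pos a ⟶ pos b) (rayᵇ k) # 0#
    det-rayᵇ k = [ (λ s → >⇒# (s (inj₂ k))) , (λ s → <⇒# (s (inj₂ k))) ]′ sameSide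

    -- Each half of the inversion governs one segment: `j < i`, the order at `b`, decides whether
    -- the meeting point precedes vertex `i` on its ray from `a`; the ranks, the order at `a`, do
    -- the same for vertex `j` on its ray from `b`.
    hubs-cross⇔ : ∀ i j → Crosses realization (spokeEdge (false , i)) (spokeEdge (true , j)) ⇔
                          Inversion π j i
    hubs-cross⇔ i j = mk⇔ inversion crossing
      where
      crossing : Inversion π j i →
                 Crosses realization (spokeEdge (false , i)) (spokeEdge (true , j))
      crossing (j<i , ri<rj) with X , X∈a , X∈b ← meet (rank i) j =
        (λ { (inj₁ (() , _)) ; (inj₂ (() , _)) }) , X ,
        crossed (det-rayᵇ i) (angleᵇ j<i) (vertexᵃ-rank i) (vertexᵇ i) X∈a X∈b ,
        crossed (det-rayᵃ (rank j)) (angleᵃ ri<rj) (vertexᵇ j) (vertexᵃ-rank j) X∈b X∈a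

      inversion : Crosses realization (spokeEdge (false , i)) (spokeEdge (true , j)) →
                  Inversion π j i
      inversion (_ , X , X∈ai , X∈bj) with i Fin.≟ j
      -- Edges that share the vertex `i` could only meet in their interiors if `i`, `a`, `b` were
      -- collinear.
      ... | yes ≡.refl = contradiction
        (interiors-meet⇒collinear (interior-sym X∈ai) (interior-sym X∈bj))
        (noCollinear {mid i} {a} {b} (λ ()) (λ ()) (λ ()))
      ... | no i≢j = j<i , ri<rj
        where
        j<i : j Fin.< i
        j<i with Fin.<-cmp j i
        ... | tri< j<i _ _ = j<i
        ... | tri≈ _ j≡i _ = contradiction (≡.sym j≡i) i≢j
        ... | tri> _ _ i<j = contradiction X∈bj
          (uncrossed (det-rayᵇ j) (angleᵇ i<j) (vertexᵃ-rank i) (vertexᵇ i) (vertexᵇ j) X∈ai)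
        ri<rj : rank i Fin.< rank j
        ri<rj with Fin.<-cmp (rank i) (rank j)
        ... | tri< ri<rj _ _ = ri<rj
        ... | tri≈ _ ri≡rj _ = contradiction
          (≡.trans (≡.sym (inverseʳ π)) (≡.trans (≡.cong (π ⟨$⟩ʳ_) ri≡rj) (inverseʳ π))) i≢j
        ... | tri> _ _ rj<ri = contradiction X∈ai
          (uncrossed (det-rayᵃ (rank i)) (angleᵃ rj<ri) (vertexᵇ j) (vertexᵃ-rank j)
            (vertexᵃ-rank i) X∈bj)

    Crosses-sym : ∀ e f → Crosses realization e f → Crosses realization f e
    Crosses-sym e f (e≉f , X , X∈e , X∈f) = e≉f ∘ SameEdge-sym f e , X , X∈f , X∈e

    Crosses-resp : ∀ {d e d′ e′} → SameEdge d d′ → SameEdge e e′ →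
                   Crosses realization d e → Crosses realization d′ e′
    Crosses-resp {d} {e} {d′} {e′} d≈d′ e≈e′ (d≉e , X , X∈d , X∈e) =
      (λ d′≈e′ → d≉e (SameEdge-trans d d′ e d≈d′
        (SameEdge-trans d′ e′ e d′≈e′ (SameEdge-sym e e′ e≈e′)))) ,
      X , onEdge-resp realization d d′ d≈d′ X∈d , onEdge-resp realization e e′ e≈e′ X∈e

    same-hub : ∀ h i j → ¬ Crosses realization (spokeEdge (h , i)) (spokeEdge (h , j))
    same-hub h i j (e≉f , X , X∈e , X∈f) =
      noCollinear (hub≢mid h) (λ mi≡mj → e≉f (inj₁ (≡.refl , mi≡mj))) (hub≢mid h)
        (interiors-meet⇒collinear X∈e X∈f)
      where
      hub≢mid : ∀ h {i : Fin n} → hub h ≢ mid i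
      hub≢mid false ()
      hub≢mid true  ()

    spokes-cross⇔ : ∀ p q → Crosses realization (spokeEdge p) (spokeEdge q) ⇔
                            Cross (Inversion π) p q
    spokes-cross⇔ (false , i) (false , j) = mk⇔ (same-hub false i j) λ ()
    spokes-cross⇔ (true  , i) (true  , j) = mk⇔ (same-hub true i j) λ ()
    spokes-cross⇔ (false , i) (true  , j) = hubs-cross⇔ i j
    spokes-cross⇔ (true  , j) (false , i) = mk⇔
      (λ x → Equivalence.to (hubs-cross⇔ i j)
        (Crosses-sym (spokeEdge (true , j)) (spokeEdge (false , i)) x))
      (λ x → Crosses-sym (spokeEdge (false , i)) (spokeEdge (true , j))
        (Equivalence.from (hubs-cross⇔ i j) x))

    crosses⇔ : ∀ e f → Crosses realization e f ⇔ Cross (Inversion π) (toSpoke e) (toSpoke f)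
    crosses⇔ e f = mk⇔
      (λ x → Equivalence.to (spokes-cross⇔ (toSpoke e) (toSpoke f))
        (Crosses-resp {e} {f} {e′} {f′} (SameEdge-sym e′ e e′≈e) (SameEdge-sym f′ f f′≈f) x))
      (λ x → Crosses-resp {e′} {f′} {e} {f} e′≈e f′≈f
        (Equivalence.from (spokes-cross⇔ (toSpoke e) (toSpoke f)) x))
      where
      e′ = spokeEdge (toSpoke e)
      f′ = spokeEdge (toSpoke f)
      e′≈e = spokeEdge-toSpoke e
      f′≈f = spokeEdge-toSpoke f

-- Automorphisms of K₂,ₙ

-- Exchanging the hubs sends the pair `a i`, `b j` to `b i`, `a j`, which reverses the relation
-- behind `Cross`.
turn : ∀ {A : Set} → Bool → Rel A 0ℓ → Rel A 0ℓ
turn false R x y = R x y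
turn true  R x y = R y x

module _ {n : ℕ} where

  inversion? : ∀ (π : Permutation′ n) → Decidable (Inversion π)
  inversion? π i j = (i Fin.<? j) ×-dec ((π ⟨$⟩ˡ j) Fin.<? (π ⟨$⟩ˡ i))

  turn? : ∀ s {R : Rel (Fin n) 0ℓ} → Decidable R → Decidable (turn s R)
  turn? false R? x y = R? x y
  turn? true  R? x y = R? y x

  Cross-mono : ∀ {R S : Rel (Fin n) 0ℓ} → (∀ {x y} → R x y → S x y) →
               ∀ {p q} → Cross R p q → Cross S p q
  Cross-mono R⇒S {false , _} {true  , _} = R⇒S
  Cross-mono R⇒S {true  , _} {false , _} = R⇒S

  Cross-relabel : ∀ (R : Rel (Fin n) 0ℓ) s φ p q →
                  Cross R (onSpoke (relabel s φ) p) (onSpoke (relabel s φ) q) ≡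
                  Cross (λ x y → turn s R (φ ⟨$⟩ʳ x) (φ ⟨$⟩ʳ y)) p q
  Cross-relabel R false φ (false , _) (false , _) = ≡.refl
  Cross-relabel R false φ (false , _) (true  , _) = ≡.refl
  Cross-relabel R false φ (true  , _) (false , _) = ≡.refl
  Cross-relabel R false φ (true  , _) (true  , _) = ≡.refl
  Cross-relabel R true  φ (false , _) (false , _) = ≡.refl
  Cross-relabel R true  φ (false , _) (true  , _) = ≡.refl
  Cross-relabel R true  φ (true  , _) (false , _) = ≡.refl
  Cross-relabel R true  φ (true  , _) (true  , _) = ≡.refl

  Cross⇒∃ : ∀ {R : Rel (Fin n) 0ℓ} p q → Cross R p q → ∃[ x ] ∃[ y ] R x y
  Cross⇒∃ (false , i) (true  , j) Rji = j , i , Rji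
  Cross⇒∃ (true  , j) (false , i) Rji = j , i , Rji

  Relabels : GraphIso (K₂ n) (K₂ n) → Bool → Permutation′ n → Set
  Relabels f s φ = ∀ p → onSpoke f p ≡ onSpoke (relabel s φ) p

  module _ (f : GraphIso (K₂ n) (K₂ n)) where
    open GraphIso f

    to-adj : ∀ {x y u v} → to x ≡ u → to y ≡ v → K₂-Adj x y → K₂-Adj u v
    to-adj ≡.refl ≡.refl = Equivalence.to (adj⇔ _ _)

    from-adj : ∀ {x y u v} → to x ≡ u → to y ≡ v → K₂-Adj u v → K₂-Adj x y
    from-adj ≡.refl ≡.refl = Equivalence.from (adj⇔ _ _)

    -- The middle vertices, being neighbours of `a`, go injectively to neighbours of `hub s`, all of
    -- them middle. As `b` is not adjacent to `a`, its image can only be the other hub.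
    hub-fixed⇒relabels : ∀ s → to a ≡ hub s → ∃[ φ ] Relabels f s φ
    hub-fixed⇒relabels s to-a =
      let φ , φ≡ = injective⇒permutation image-injective in
      φ , λ { (h , i) → ≡.trans
        (toSpoke-ends (onEdge (spokeEdge (h , i))) (to-hub h)
          (≡.trans (proj₂ (image i)) (≡.cong mid (≡.sym (φ≡ i)))))
        (≡.sym (onSpoke-relabel s φ h i)) }
      where
      hub-neighbour : ∀ s {x} → K₂-Adj (hub s) x → ∃[ j ] x ≡ mid j
      hub-neighbour false {mid j} _ = j , ≡.refl
      hub-neighbour true  {mid j} _ = j , ≡.refl
      image : ∀ i → ∃[ j ] to (mid i) ≡ mid j
      image i = hub-neighbour s (to-adj to-a ≡.refl tt)
      image-injective : Injective _≡_ _≡_ (proj₁ ∘ image)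
      image-injective {i} {j} eq = mid-injective (to-injective f
        (≡.trans (proj₂ (image i)) (≡.trans (≡.cong mid eq) (≡.sym (proj₂ (image j))))))
      other-hub : ∀ s {x} → x ≢ hub s → ¬ K₂-Adj (hub s) x → x ≡ hub (not s)
      other-hub false {a}     x≢ _  = contradiction ≡.refl x≢
      other-hub false {b}     _  _  = ≡.refl
      other-hub false {mid _} _  ¬A = contradiction tt ¬A
      other-hub true  {a}     _  _  = ≡.refl
      other-hub true  {b}     x≢ _  = contradiction ≡.refl x≢
      other-hub true  {mid _} _  ¬A = contradiction tt ¬A
      to-hub : ∀ h → to (hub h) ≡ hub (s xor h)
      to-hub false = ≡.trans to-a (≡.cong hub (≡.sym (Bool.xor-identityʳ s)))
      to-hub true  = ≡.trans
        (other-hub s (λ eq → a≢b (to-injective f (≡.trans to-a (≡.sym eq))))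
          (from-adj {a} {b} to-a ≡.refl))
        (≡.cong hub (≡.trans (≡.sym (Bool.true-xor s)) (Bool.xor-comm true s)))
        where
        a≢b : a ≢ b {n}
        a≢b ()

    -- The `n` neighbours of `a` inject into the two neighbours of `mid k`, so `n` is at most 2;
    -- `b`, not adjacent to `a`, goes to a second middle vertex, so `n` is at least 2.
    hub-moved⇒n≡2 : ∀ k → to a ≡ mid k → n ≡ 2
    hub-moved⇒n≡2 k to-a = ℕ.≤-antisym
      (Fin.injective⇒≤ {f = Inverse.from Fin.2↔Bool ∘ proj₁ ∘ image}
        (image-injective ∘ Injection.injective (↔⇒↣ (↔-sym Fin.2↔Bool))))
      (Fin.injective⇒≤ {f = hubImage} hubImage-injective)
      where
      mid-neighbour : ∀ {x : K₂-Vertex n} → K₂-Adj (mid k) x → ∃[ h ] x ≡ hub h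
      mid-neighbour {a} _ = false , ≡.refl
      mid-neighbour {b} _ = true , ≡.refl
      image : ∀ i → ∃[ h ] to (mid i) ≡ hub h
      image i = mid-neighbour (to-adj {a} {mid i} to-a ≡.refl tt)
      image-injective : Injective _≡_ _≡_ (proj₁ ∘ image)
      image-injective {i} {j} eq = mid-injective (to-injective f
        (≡.trans (proj₂ (image i)) (≡.trans (≡.cong hub eq) (≡.sym (proj₂ (image j))))))
      mid-non-neighbour : ∀ {x : K₂-Vertex n} → ¬ K₂-Adj (mid k) x → ∃[ j ] x ≡ mid j
      mid-non-neighbour {a}     ¬A = contradiction tt ¬A
      mid-non-neighbour {b}     ¬A = contradiction tt ¬A
      mid-non-neighbour {mid j} _  = j , ≡.refl
      to-b : ∃[ l ] to b ≡ mid l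
      to-b = mid-non-neighbour (from-adj {a} {b} to-a ≡.refl)
      k≢l : k ≢ proj₁ to-b
      k≢l eq with to-injective f {a} {b}
        (≡.trans to-a (≡.trans (≡.cong mid eq) (≡.sym (proj₂ to-b))))
      ... | ()
      hubImage : Fin 2 → Fin n
      hubImage 0F = k
      hubImage 1F = proj₁ to-b
      hubImage-injective : Injective _≡_ _≡_ hubImage
      hubImage-injective {0F} {0F} _  = ≡.refl
      hubImage-injective {0F} {1F} eq = contradiction eq k≢l
      hubImage-injective {1F} {0F} eq = contradiction (≡.sym eq) k≢l
      hubImage-injective {1F} {1F} _  = ≡.refl

    classify : (∃[ s ] ∃[ φ ] Relabels f s φ) ⊎ n ≡ 2
    classify with to a in to-a
    ... | a     = inj₁ (false , hub-fixed⇒relabels false to-a)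
    ... | b     = inj₁ (true , hub-fixed⇒relabels true to-a)
    ... | mid k = inj₂ (hub-moved⇒n≡2 k to-a)

-- Embeddings of inversion digraphs

Embeds : ∀ {n} → Rel (Fin n) 0ℓ → Rel (Fin n) 0ℓ → Permutation′ n → Set
Embeds R S φ = ∀ {x y} → R x y → S (φ ⟨$⟩ʳ x) (φ ⟨$⟩ʳ y)

-- Since `φ` is onto, the missed arc can be named by the preimages of its ends.
StrictlyEmbeds : ∀ {n} → Rel (Fin n) 0ℓ → Rel (Fin n) 0ℓ → Permutation′ n → Set
StrictlyEmbeds R S φ = Embeds R S φ × ∃[ x ] ∃[ y ] (S (φ ⟨$⟩ʳ x) (φ ⟨$⟩ʳ y) × ¬ R x y)

Fin2-inversion : ∀ (π : Permutation′ 2) {x y} → Inversion π x y → x ≡ 0F × y ≡ 1F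
Fin2-inversion π {0F} {1F} _              = ≡.refl , ≡.refl
Fin2-inversion π {1F} {1F} (s≤s () , _)

-- An automorphism of K₂,₂ may exchange {a, b} with {1, 2}.  There is at most one crossing then,
-- and the identity will do.
crossing-preserving⇒embeds :
  ∀ {n} (σ π : Permutation′ n) (f : GraphIso (K₂ n) (K₂ n)) →
  (∀ {p q} → Cross (Inversion σ) p q → Cross (Inversion π) (onSpoke f p) (onSpoke f q)) →
  ∃[ s ] ∃[ φ ] Embeds (Inversion σ) (turn s (Inversion π)) φ
crossing-preserving⇒embeds σ π f f-pres with classify f
... | inj₁ (s , φ , f≡) = s , φ , λ {x} {y} σxy →
  ≡.subst id (Cross-relabel (Inversion π) s φ (false , y) (true , x))
    (≡.subst₂ (Cross (Inversion π)) (f≡ _) (f≡ _) (f-pres {false , y} {true , x} σxy))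
... | inj₂ ≡.refl = false , Perm.id , embed
  where
  embed : Embeds (Inversion σ) (Inversion π) Perm.id
  embed {x} {y} σxy
    -- Only the existence of some inversion of `π` is kept: with two indices it must be `(0F , 1F)`,
    -- as must the one of `σ`.
    with u , v , πuv ← Cross⇒∃ (onSpoke f (false , y)) (onSpoke f (true , x))
                         (f-pres {false , y} {true , x} σxy)
    with ≡.refl , ≡.refl ← Fin2-inversion σ σxy
    with ≡.refl , ≡.refl ← Fin2-inversion π πuv = πuv

module _ {n} (σ ρ : Permutation′ n) where

  isoToProper⇒strict : IsoToProperSubdigraph (D σ) (D ρ) →
                       ∃ (StrictlyEmbeds (Inversion σ) (Inversion ρ))
  isoToProper⇒strict (S , proper , iso) = φ , (λ {x} {y} σxy → S.arc (to-arc σxy)) , strict proper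
    where
    module S = Subdigraph S
    module ι = _≅_ iso
    φ = proj₁ (injective⇒permutation ι.injective)
    φ≡ = proj₂ (injective⇒permutation ι.injective)
    to-arc : ∀ {x y} → Inversion σ x y → S.ArcIn (φ ⟨$⟩ʳ x) (φ ⟨$⟩ʳ y)
    to-arc {x} {y} σxy = ≡.subst₂ S.ArcIn (≡.sym (φ≡ x)) (≡.sym (φ≡ y))
      (Equivalence.to (ι.arcs x y) σxy)
    strict : S.Proper → ∃[ x ] ∃[ y ] (Inversion ρ (φ ⟨$⟩ʳ x) (φ ⟨$⟩ʳ y) × ¬ Inversion σ x y)
    -- Both digraphs have `n` nodes, so the injection is onto and no node can be missing.
    strict (inj₁ (x , x∉S)) = contradiction
      (Equivalence.from (ι.image x) (φ ⟨$⟩ˡ x , ≡.trans (≡.sym (φ≡ _)) (inverseʳ φ))) x∉S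
    strict (inj₂ (x , y , ρxy , xy∉S)) = φ ⟨$⟩ˡ x , φ ⟨$⟩ˡ y ,
      ≡.subst₂ (Inversion ρ) (≡.sym (inverseʳ φ)) (≡.sym (inverseʳ φ)) ρxy ,
      xy∉S ∘ ≡.subst₂ S.ArcIn (inverseʳ φ) (inverseʳ φ) ∘ to-arc

  -- The subdigraph is spanning and its arcs are just the images under `φ`, so the missed arc makes
  -- it proper.
  strict⇒isoToProper : ∃ (StrictlyEmbeds (Inversion σ) (Inversion ρ)) →
                       IsoToProperSubdigraph (D σ) (D ρ)
  strict⇒isoToProper (φ , embed , x , y , ρxy , ¬σxy) =
    record
      { NodeIn = λ _ → ⊤
      ; ArcIn  = λ x y → Inversion σ (φ ⟨$⟩ˡ x) (φ ⟨$⟩ˡ y)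
      ; arc    = λ σxy → ≡.subst₂ (Inversion ρ) (inverseʳ φ) (inverseʳ φ) (embed σxy)
      ; source = λ _ → tt
      ; target = λ _ → tt
      } ,
    inj₂ (φ ⟨$⟩ʳ x , φ ⟨$⟩ʳ y , ρxy , ¬σxy ∘ ≡.subst₂ (Inversion σ) (inverseˡ φ) (inverseˡ φ)) ,
    record
      { to        = φ ⟨$⟩ʳ_
      ; injective = Injection.injective (↔⇒↣ φ)
      ; image     = λ y → mk⇔ (λ _ → φ ⟨$⟩ˡ y , inverseʳ φ) (λ _ → tt)
      ; arcs      = λ x y → mk⇔
          (≡.subst₂ (Inversion σ) (≡.sym (inverseˡ φ)) (≡.sym (inverseˡ φ)))
          (≡.subst₂ (Inversion σ) (inverseˡ φ) (inverseˡ φ))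
      }

StrictlyEmbeds-∘ : ∀ {n} {R : Rel (Fin n) 0ℓ} (S T : Rel (Fin n) 0ℓ) (ψ : Permutation′ n) →
                   (∀ {x y} → S x y → T (ψ ⟨$⟩ʳ x) (ψ ⟨$⟩ʳ y)) →
                   ∃ (StrictlyEmbeds R S) → ∃ (StrictlyEmbeds R T)
StrictlyEmbeds-∘ S T ψ S⇒T (φ , embed , x , y , Sxy , ¬Rxy) =
  φ ∘ₚ ψ , S⇒T ∘ embed , x , y , S⇒T Sxy , ¬Rxy

-- `π` exchanges positions with values, hence carries the digraph of its inverse onto the reversed
-- digraph of `π`.
flip-inversion : ∀ {n} (π : Permutation′ n) {x y} →
                 Inversion (flip π) x y → Inversion π (π ⟨$⟩ʳ y) (π ⟨$⟩ʳ x)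
flip-inversion π (x<y , πy<πx) =
  πy<πx , ≡.subst₂ Fin._<_ (≡.sym (inverseˡ π)) (≡.sym (inverseˡ π)) x<y

module _ {n} (σ π : Permutation′ n) where

  Smaller : Set
  Smaller = ∃[ s ] ∃ (StrictlyEmbeds (Inversion σ) (turn s (Inversion π)))

  subdigraph⇔smaller : (IsoToProperSubdigraph (D σ) (D π) ⊎
                        IsoToProperSubdigraph (D σ) (D (flip π))) ⇔ Smaller
  subdigraph⇔smaller = mk⇔ to from
    where
    reversed = turn true (Inversion π)
    to : _ ⊎ _ → Smaller
    to (inj₁ S) = false , isoToProper⇒strict σ π S
    to (inj₂ S) = true ,
      StrictlyEmbeds-∘ (Inversion (flip π)) reversed π (flip-inversion π)
        (isoToProper⇒strict σ (flip π) S)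
    from : Smaller → _ ⊎ _
    from (false , strict) = inj₁ (strict⇒isoToProper σ π strict)
    -- `flip (flip π)` has the inversions of `π` by computation, so the same lemma also leads back.
    from (true  , strict) = inj₂ (strict⇒isoToProper σ (flip π)
      (StrictlyEmbeds-∘ reversed (Inversion (flip π)) (flip π) (flip-inversion (flip π)) strict))

-- Comparing the drawings of two permutations

module _ {c ℓ₁ ℓ₂ ℓ₃} (ℝ : Reals c ℓ₁ ℓ₂ ℓ₃) {n : ℕ} (K̄ : Plane.Drawings ℝ n) where

  open Plane ℝ
  open Plane.Order ℝ K̄
  open Drawing ℝ

  private
    drawing : (π : Permutation′ n) → Realization (K₂ n)
    drawing π = RayDrawing.realization (K̄ π)

  module _ (f : GraphIso (K₂ n) (K₂ n)) (π : Permutation′ n) where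
    open GraphIso f

    onEdge-crosses⇔ : ∀ e e′ → Crosses (drawing π) (onEdge e) (onEdge e′) ⇔
                      Cross (Inversion π) (onSpoke f (toSpoke e)) (onSpoke f (toSpoke e′))
    onEdge-crosses⇔ e e′ = ≡.subst₂
      (λ p q → Crosses (drawing π) (onEdge e) (onEdge e′) ⇔ Cross (Inversion π) p q)
      (≡.sym (onSpoke-toSpoke f e)) (≡.sym (onSpoke-toSpoke f e′))
      (crosses⇔ (K̄ π) (onEdge e) (onEdge e′))

  module _ (σ π : Permutation′ n) where

    ≼⇒preserves : ((f , _) : σ ≼ π) → ∀ {p q} →
                  Cross (Inversion σ) p q → Cross (Inversion π) (onSpoke f p) (onSpoke f q)
    ≼⇒preserves (f , f-pres) {p} {q} x = let open GraphIso f in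
      Equivalence.to (crosses⇔ (K̄ π) (onEdge (spokeEdge p)) (onEdge (spokeEdge q)))
        (f-pres (spokeEdge p) (spokeEdge q) (Equivalence.from (spokes-cross⇔ (K̄ σ) p q) x))

    ∼⇒reflects : ((f , _) : σ ∼ π) → ∀ {p q} →
                 Cross (Inversion π) (onSpoke f p) (onSpoke f q) → Cross (Inversion σ) p q
    ∼⇒reflects (f , f-pres) {p} {q} x = let open GraphIso f in
      Equivalence.to (spokes-cross⇔ (K̄ σ) p q)
        (Equivalence.from (f-pres (spokeEdge p) (spokeEdge q))
        (Equivalence.from (crosses⇔ (K̄ π) (onEdge (spokeEdge p)) (onEdge (spokeEdge q))) x))

    module _ (s : Bool) (φ : Permutation′ n) where
      open GraphIso (relabel s φ) using (onEdge)

      relabel-preserves : Embeds (Inversion σ) (turn s (Inversion π)) φ → ∀ e e′ →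
                          Crosses (drawing σ) e e′ → Crosses (drawing π) (onEdge e) (onEdge e′)
      relabel-preserves embed e e′ x = Equivalence.from (onEdge-crosses⇔ (relabel s φ) π e e′)
        (≡.subst id (≡.sym (Cross-relabel (Inversion π) s φ (toSpoke e) (toSpoke e′)))
          (Cross-mono embed {toSpoke e} {toSpoke e′} (Equivalence.to (crosses⇔ (K̄ σ) e e′) x)))

      relabel-reflects : (∀ {x y} → turn s (Inversion π) (φ ⟨$⟩ʳ x) (φ ⟨$⟩ʳ y) → Inversion σ x y) →
                         ∀ e e′ →
                         Crosses (drawing π) (onEdge e) (onEdge e′) → Crosses (drawing σ) e e′
      relabel-reflects reflect e e′ x = Equivalence.from (crosses⇔ (K̄ σ) e e′)
        (Cross-mono reflect {toSpoke e} {toSpoke e′}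
          (≡.subst id (Cross-relabel (Inversion π) s φ (toSpoke e) (toSpoke e′))
            (Equivalence.to (onEdge-crosses⇔ (relabel s φ) π e e′) x)))

    smaller⇒≺ : Smaller σ π → σ ≺ π
    smaller⇒≺ (s , φ , embed , x , y , πxy , ¬σxy) = σ≼π , σ≁π
      where
      f = relabel s φ
      σ≼π : σ ≼ π
      σ≼π = f , relabel-preserves s φ embed
      σ≁π : ¬ σ ∼ π
      -- Crossings of `σ` go forward along `f`, those of `π` back along `g`; so `f` would reflect
      -- crossings too. The missed arc from `x` to `y` is the pair of edges `a y`, `b x`, which
      -- crosses only after `f`.
      σ≁π σ∼π@(g , _) = ¬σxy (reflects spokes↣
        {R = λ (p , q) → Cross (Inversion π) p q} {S = λ (p , q) → Cross (Inversion σ) p q}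
        (pairwise-injective f) (pairwise-injective g)
        (λ { {p , q} → ≼⇒preserves σ≼π {p} {q} }) (λ { {p , q} → ∼⇒reflects σ∼π {p} {q} })
        {(false , y) , (true , x)}
        (≡.subst id (≡.sym (Cross-relabel (Inversion π) s φ (false , y) (true , x))) πxy))
        where
        pairwise-injective : ∀ f → Injective _≡_ _≡_ (Product.map (onSpoke f) (onSpoke f))
        pairwise-injective f eq = ≡.cong₂ _,_
          (onSpoke-injective f (≡.cong proj₁ eq)) (onSpoke-injective f (≡.cong proj₂ eq))

    ≺⇒smaller : σ ≺ π → Smaller σ π
    ≺⇒smaller (σ≼π@(f , _) , σ≁π)
      with s , φ , embed ← crossing-preserving⇒embeds σ π f (≼⇒preserves σ≼π)
      -- If no arc is missed, `relabel s φ` reflects crossings as well and is a geo-isomorphism. It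
      -- replaces `f`, which need not itself be a relabelling.
      with Fin.any? (λ x → Fin.any? (λ y →
             turn? s (inversion? π) (φ ⟨$⟩ʳ x) (φ ⟨$⟩ʳ y) ×-dec ¬? (inversion? σ x y)))
    ... | yes strict = s , φ , embed , strict
    ... | no ¬strict = contradiction
      (relabel s φ , λ e e′ → mk⇔ (relabel-preserves s φ embed e e′)
        (relabel-reflects s φ reflect e e′)) σ≁π
      where
      reflect : ∀ {x y} → turn s (Inversion π) (φ ⟨$⟩ʳ x) (φ ⟨$⟩ʳ y) → Inversion σ x y
      reflect {x} {y} πxy = decidable-stable (inversion? σ x y)
        (λ ¬σxy → ¬strict (x , y , πxy , ¬σxy))

proposition6 :
  ∀ {c ℓ₁ ℓ₂ ℓ₃} (ℝ : Reals c ℓ₁ ℓ₂ ℓ₃) (n : ℕ) (K̄ : Plane.Drawings ℝ n)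
    (σ π : Permutation′ n) →
    Plane.Order._≺_ ℝ K̄ σ π ⇔
      (IsoToProperSubdigraph (D σ) (D π) ⊎
       IsoToProperSubdigraph (D σ) (D (flip π)))
proposition6 ℝ n K̄ σ π = mk⇔
  (Equivalence.from (subdigraph⇔smaller σ π) ∘ ≺⇒smaller ℝ K̄ σ π)
  (smaller⇒≺ ℝ K̄ σ π ∘ Equivalence.to (subdigraph⇔smaller σ π))
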